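{- Let $k \geq 3$, $e \geq 2$ and $t\ge1$ be integers. If $M$ is a $k$-nestable ordered $k$-uniform matching with $e$ edges, then \[ R_{<,t}(M) \leq (ek)^{(2e-1)^{t-1}} = 2^{(2e-1)^{t-1}\log_2(ek)}. \]
   Context: An ordered hypergraph $G$ is contained in an ordered hypergraph $H$ if there is an injective order-preserving map $V(G)\to V(H)$ sending every edge of $G$ to an edge of $H$. $K_N^k$ is the complete $k$-uniform hypergraph on $[N]=\{1,\dots,N\}$ with the natural order. $R_{<,t}(G)$ is the least $N$ such that every coloring $c:E(K_N^k)\to[t]$ has a color class containing $G$. An ordered $k$-uniform matching $M$ with $e$ edges on vertex set $[ke]$ (pairwise disjoint edges covering $[ke]$) is $k$-nestable if there exist pairwise disjoint intervals $I_1,\dots,I_k$ of integers (some possibly empty or single points), consecutive in this order, whose union is $[ke]$, with $1\in I_1$ and $ke\in I_k$, such that every edge of $M$ either is contained in some $I_j$ or meets every one of $I_1,\dots,I_k$, and for each $j\in[k]$ the edges contained in $I_j$ form a matching that is either empty or (after order-preserving relabeling of its vertex set) itself $k$-nestable. This definition is recursive. -}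

module Defs where

open import Data.Nat using (ℕ; zero; suc; _+_; _*_; _∸_; _^_; _≤_; _<_)
open import Data.Fin using (Fin; toℕ) renaming (_<_ to _<ᶠ_; _≤_ to _≤ᶠ_)
open import Data.Fin.Subset using (Subset; _∈_; ∣_∣)
open import Data.Product using (Σ; ∃; _×_; _,_)
open import Data.Sum using (_⊎_)
open import Data.Empty using (⊥)
open import Relation.Nullary using (¬_)
open import Relation.Binary.PropositionalEquality using (_≡_; _≢_)

-- An ordered hypergraph on the vertex set Fin n (ordered naturally),
-- given by its edge predicate on subsets of the vertex set.
record Hypergraph (n : ℕ) : Set₁ where
  field
    Edge : Subset n → Set
open Hypergraph public

ImageOf : ∀ {m n} → (Fin m → Fin n) → Subset m → Subset n → Set
ImageOf {m} {n} f s s' = (y : Fin n) → (y ∈ s' → Σ (Fin m) λ x → x ∈ s × f x ≡ y)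
                                      × ((x : Fin m) → x ∈ s → f x ≡ y → y ∈ s')

OrderEmbedding : ∀ {m n} → (Fin m → Fin n) → Set
OrderEmbedding {m} f = (x y : Fin m) → x <ᶠ y → f x <ᶠ f y

_⊑_ : ∀ {m n} → Hypergraph m → Hypergraph n → Set
_⊑_ {m} {n} G H = Σ (Fin m → Fin n) λ f → OrderEmbedding f
  × ((s : Subset m) → Edge G s → Σ (Subset n) λ s' → ImageOf f s s' × Edge H s')

Coloring : ℕ → ℕ → ℕ → Set
Coloring N k t = (s : Subset N) → ∣ s ∣ ≡ k → Fin t

ColorClass : ∀ {N k t} → Coloring N k t → Fin t → Hypergraph N
ColorClass {N} {k} c i = record { Edge = λ s → Σ (∣ s ∣ ≡ k) λ p → c s p ≡ i }

RamseyAt : ∀ {m} → (k t : ℕ) → Hypergraph m → ℕ → Set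
RamseyAt k t G N = (c : Coloring N k t) → Σ (Fin t) λ i → G ⊑ ColorClass c i

-- R_{<,t}(G) ≤ B  (the least N with the Ramsey property is at most B)
RamseyLe : ∀ {m} → (k t : ℕ) → Hypergraph m → ℕ → Set
RamseyLe k t G B = Σ ℕ λ N → N ≤ B × RamseyAt k t G N

record Matching (k e : ℕ) : Set where
  field
    edge     : Fin e → Subset (k * e)
    size     : (j : Fin e) → ∣ edge j ∣ ≡ k
    disjoint : (i j : Fin e) → i ≢ j → (x : Fin (k * e)) → x ∈ edge i → x ∈ edge j → ⊥
    cover    : (x : Fin (k * e)) → Σ (Fin e) λ j → x ∈ edge j
open Matching public

asHypergraph : ∀ {k e} → Matching k e → Hypergraph (k * e)
asHypergraph {k} {e} M = record { Edge = λ s → Σ (Fin e) λ j → s ≡ edge M j }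

-- k-nestability. The intervals I_1,...,I_k are encoded by the interval-index
-- map φ : [ke] → Fin k (I_{j+1} = φ⁻¹ j); φ monotone ⇔ the I_j are consecutive
-- intervals in this order (possibly empty) covering [ke].
data Nestable {k : ℕ} : {e : ℕ} → Matching k e → Set where
  nest : ∀ {e} {M : Matching k e}
    (φ : Fin (k * e) → Fin k)
    → ((x y : Fin (k * e)) → x ≤ᶠ y → φ x ≤ᶠ φ y)
    → Σ (Fin (k * e)) (λ x → toℕ x ≡ 0 × toℕ (φ x) ≡ 0)
    → Σ (Fin (k * e)) (λ x → toℕ x ≡ k * e ∸ 1 × toℕ (φ x) ≡ k ∸ 1)
    → ((j : Fin e) → Σ (Fin k) (λ i → (x : Fin (k * e)) → x ∈ edge M j → φ x ≡ i)
                    ⊎ ((i : Fin k) → Σ (Fin (k * e)) λ x → x ∈ edge M j × φ x ≡ i))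
    -- for each interval, the edges inside it form an empty matching or
    -- (after order-preserving relabeling g of their vertex set) a nestable one
    → ((i : Fin k) →
         ((j : Fin e) → ¬ ((x : Fin (k * e)) → x ∈ edge M j → φ x ≡ i))
       ⊎ (Σ ℕ λ e' → Σ (Matching k e') λ M' → Σ (Fin (k * e') → Fin (k * e)) λ g →
            OrderEmbedding g
          × ((j' : Fin e') → Σ (Fin e) λ j →
                ((x : Fin (k * e)) → x ∈ edge M j → φ x ≡ i) × ImageOf g (edge M' j') (edge M j))
          × ((j : Fin e) → ((x : Fin (k * e)) → x ∈ edge M j → φ x ≡ i) →
                Σ (Fin e') λ j' → ImageOf g (edge M' j') (edge M j))
          × Nestable M'))
    → Nestable M

{-# OPTIONS --safe #-}
module Submission where

-- Induction on the number of colours: if B ≥ ek vertices force M in t colours, then B^(2e−1)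
-- vertices force it in t + 1. By induction on a nestable matching M' with e' edges, every
-- colouring of B^(2e'−1) vertices has a copy of M' in the extra colour, red, or a copy of M in
-- another colour. Cut the vertices into B blocks of length B^(2e'−2). The matching inside an
-- interval of M' has at most e' − 1 edges, so by induction each block contains a red copy of it,
-- found among points B apart so that the other vertices of the interval fit in between. Hence
-- every k-set of blocks carries a placement of M' in which all non-crossing edges are red. If
-- no placement is entirely red, each k-set of blocks is spanned by a non-red edge; its colour
-- is a t-colouring of the k-sets of blocks, and a monochromatic M there lifts to the vertices.

open import Defs
open import Data.Nat using (ℕ; _*_; _∸_; _^_; _≤_)

open import Data.Empty using (⊥-elim)
open import Data.Fin using (Fin; zero; suc; toℕ; fromℕ<; cast; combine; inject≤)
  renaming (_<_ to _<ᶠ_; _≤_ to _≤ᶠ_)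
open import Data.Fin.Properties as Fin using (any?; all?; toℕ-injective; injective⇒≤)
open import Data.Fin.Subset using (Subset; _∈_; _⊆_; ∣_∣; inside; outside)
open import Data.Fin.Subset.Properties using (_∈?_; ⊆-antisym; p⊂q⇒∣p∣<∣q∣; anySubset?)
open import Data.Nat using (zero; suc; _+_; _<_; z≤n; s≤s; NonZero; >-nonZero)
open import Data.Nat.Properties as ℕ using ()
open import Data.Product using (Σ; ∃; _×_; _,_; proj₁; proj₂)
open import Data.Sum using (_⊎_; inj₁; inj₂)
open import Data.Vec using (_∷_; tabulate; here; there)
open import Data.Vec.Properties using (lookup∘tabulate; lookup⇒[]=; []=⇒lookup)
open import Function using (_∘_; Injective)
open import Relation.Nullary using (¬_; yes; no; does; contradiction; _×-dec_; _⊎-dec_)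
open import Relation.Nullary.Decidable using (dec-true; map′)
open import Relation.Unary using (Decidable)
open import Relation.Binary.Definitions using (tri<; tri≈; tri>)
open import Relation.Binary.PropositionalEquality

private variable
  k e m n p t B N : ℕ

-- Order embeddings between finite ordinals

embedding-injective : {f : Fin m → Fin n} → OrderEmbedding f → Injective _≡_ _≡_ f
embedding-injective {f = f} f-emb {x} {y} fx≡fy with Fin.<-cmp x y
... | tri< x<y _ _ = contradiction fx≡fy (Fin.<⇒≢ (f-emb x y x<y))
... | tri≈ _ x≡y _ = x≡y
... | tri> _ _ x>y = contradiction (sym fx≡fy) (Fin.<⇒≢ (f-emb y x x>y))

-- Sending an extra point to the missed value keeps the map injective. This turns a vertex outside
-- an interval into a strict drop in the number of edges.
embedding-missing⇒< : {f : Fin m → Fin n} → OrderEmbedding f → (z : Fin n) → (∀ x → f x ≢ z) → m < n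
embedding-missing⇒< {m} {n} {f} f-emb z miss = injective⇒≤ {f = f⁺} f⁺-inj
  where
  f⁺ : Fin (suc m) → Fin n
  f⁺ zero    = z
  f⁺ (suc x) = f x
  f⁺-inj : Injective _≡_ _≡_ f⁺
  f⁺-inj {zero}  {zero}  _  = refl
  f⁺-inj {zero}  {suc y} eq = contradiction (sym eq) (miss y)
  f⁺-inj {suc x} {zero}  eq = contradiction eq (miss x)
  f⁺-inj {suc x} {suc y} eq = cong suc (embedding-injective f-emb eq)

inject≤-embedding : (m≤n : m ≤ n) → OrderEmbedding (λ x → inject≤ x m≤n)
inject≤-embedding m≤n x y x<y =
  subst₂ _<_ (sym (Fin.toℕ-inject≤ x m≤n)) (sym (Fin.toℕ-inject≤ y m≤n)) x<y

combine-monoʳ-< : (b : Fin m) {i j : Fin n} → i <ᶠ j → combine b i <ᶠ combine b j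
combine-monoʳ-< {n = n} b {i} {j} i<j =
  subst₂ _<_ (sym (Fin.toℕ-combine b i)) (sym (Fin.toℕ-combine b j)) (ℕ.+-monoʳ-< (n * toℕ b) i<j)

-- Enumeration of subsets and cardinalities

enum : (p : Subset n) → Fin ∣ p ∣ → Fin n
enum (inside  ∷ p) zero    = zero
enum (inside  ∷ p) (suc i) = suc (enum p i)
enum (outside ∷ p) i       = suc (enum p i)

enum-∈ : (p : Subset n) (i : Fin ∣ p ∣) → enum p i ∈ p
enum-∈ (inside  ∷ p) zero    = here
enum-∈ (inside  ∷ p) (suc i) = there (enum-∈ p i)
enum-∈ (outside ∷ p) i       = there (enum-∈ p i)

enum-embedding : (p : Subset n) → OrderEmbedding (enum p)
enum-embedding (inside  ∷ p) zero    (suc j) _         = s≤s z≤n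
enum-embedding (inside  ∷ p) (suc i) (suc j) (s≤s i<j) = s≤s (enum-embedding p i j i<j)
enum-embedding (outside ∷ p) i       j       i<j       = s≤s (enum-embedding p i j i<j)

enum-surjective : (p : Subset n) {x : Fin n} → x ∈ p → Σ (Fin ∣ p ∣) λ i → enum p i ≡ x
enum-surjective (inside  ∷ p) here        = zero , refl
enum-surjective (inside  ∷ p) (there x∈p) =
  let i , eq = enum-surjective p x∈p in suc i , cong suc eq
enum-surjective (outside ∷ p) (there x∈p) =
  let i , eq = enum-surjective p x∈p in i , cong suc eq

-- The map may use the membership proof: a preimage under `image` is available only for members.
∣∣-mono-injection : {p : Subset m} {q : Subset n} (f : ∀ x → x ∈ p → Fin n) →
  (∀ x x∈p → f x x∈p ∈ q) → (∀ x y x∈p y∈p → f x x∈p ≡ f y y∈p → x ≡ y) → ∣ p ∣ ≤ ∣ q ∣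
∣∣-mono-injection {p = p} {q} f f∈q f-inj = injective⇒≤ {f = proj₁ ∘ index} λ {i} {j} eq →
  embedding-injective (enum-embedding p) (f-inj _ _ _ _
    (trans (sym (proj₂ (index i))) (trans (cong (enum q) eq) (proj₂ (index j)))))
  where
  index : (i : Fin ∣ p ∣) → Σ (Fin ∣ q ∣) λ l → enum q l ≡ f (enum p i) (enum-∈ p i)
  index i = enum-surjective q (f∈q _ (enum-∈ p i))

⊆∧∣≡∣⇒≡ : {p q : Subset n} → p ⊆ q → ∣ p ∣ ≡ ∣ q ∣ → p ≡ q
⊆∧∣≡∣⇒≡ {p = p} {q} p⊆q eq = ⊆-antisym p⊆q q⊆p
  where
  q⊆p : q ⊆ p
  q⊆p {x} x∈q with x ∈? p
  ... | yes x∈p = x∈p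
  ... | no  x∉p = contradiction eq (ℕ.<⇒≢ (p⊂q⇒∣p∣<∣q∣ (p⊆q , x , x∈q , x∉p)))

-- Opaque, since unification would otherwise unfold the search for a preimage.
opaque
  image : (Fin m → Fin n) → Subset m → Subset n
  image f s = tabulate λ y → does (any? λ x → (x ∈? s) ×-dec (f x Fin.≟ y))

  ∈-image⁺ : (f : Fin m → Fin n) (s : Subset m) {x : Fin m} → x ∈ s → f x ∈ image f s
  ∈-image⁺ f s {x} x∈s = lookup⇒[]= (f x) _
    (trans (lookup∘tabulate _ (f x)) (dec-true (any? _) (x , x∈s , refl)))

  ∈-image⁻ : (f : Fin m → Fin n) (s : Subset m) {y : Fin n} →
    y ∈ image f s → Σ (Fin m) λ x → x ∈ s × f x ≡ y
  ∈-image⁻ f s {y} y∈ with any? (λ x → (x ∈? s) ×-dec (f x Fin.≟ y))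
                         | trans (sym (lookup∘tabulate (λ y → does (any? λ x → (x ∈? s) ×-dec (f x Fin.≟ y))) y))
                                 ([]=⇒lookup y∈)
  ... | yes found | _  = found
  ... | no  _     | ()

module _ (f : Fin m → Fin n) (s : Subset m) where

  image-ImageOf : ImageOf f s (image f s)
  image-ImageOf y = ∈-image⁻ f s , λ x x∈s fx≡y → subst (_∈ image f s) fx≡y (∈-image⁺ f s x∈s)

  ImageOf⇒≡image : ∀ {s'} → ImageOf f s s' → s' ≡ image f s
  ImageOf⇒≡image {s'} im = ⊆-antisym
    (λ y∈s' → let x , x∈s , fx≡y = proj₁ (im _) y∈s' in
      subst (_∈ image f s) fx≡y (∈-image⁺ f s x∈s))
    (λ y∈ → let x , x∈s , fx≡y = ∈-image⁻ f s y∈ in proj₂ (im _) x x∈s fx≡y)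

  ∣image∣ : OrderEmbedding f → ∣ image f s ∣ ≡ ∣ s ∣
  ∣image∣ f-emb = ℕ.≤-antisym
    (∣∣-mono-injection (λ _ y∈ → proj₁ (∈-image⁻ f s y∈))
      (λ _ y∈ → proj₁ (proj₂ (∈-image⁻ f s y∈)))
      λ _ _ y∈ z∈ eq → trans (sym (proj₂ (proj₂ (∈-image⁻ f s y∈))))
                             (trans (cong f eq) (proj₂ (proj₂ (∈-image⁻ f s z∈)))))
    (∣∣-mono-injection (λ x _ → f x) (λ _ → ∈-image⁺ f s) λ _ _ _ _ → embedding-injective f-emb)

image-cong : {f g : Fin m → Fin n} {s : Subset m} → (∀ x → x ∈ s → f x ≡ g x) → image f s ≡ image g s
image-cong {f = f} {g} {s} f≗g = ImageOf⇒≡image g s λ y →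
  (λ y∈ → let x , x∈s , fx≡y = ∈-image⁻ f s y∈ in x , x∈s , trans (sym (f≗g x x∈s)) fx≡y) ,
  λ x x∈s gx≡y → subst (_∈ image f s) (trans (f≗g x x∈s) gx≡y) (∈-image⁺ f s x∈s)

image-∘ : (f : Fin n → Fin p) (g : Fin m → Fin n) (s : Subset m) →
  image f (image g s) ≡ image (f ∘ g) s
image-∘ f g s = ImageOf⇒≡image (f ∘ g) s λ y →
  (λ y∈ → let z , z∈ , fz≡y = ∈-image⁻ f _ y∈
              x , x∈s , gx≡z = ∈-image⁻ g s z∈ in x , x∈s , trans (cong f gx≡z) fz≡y) ,
  λ x x∈s fgx≡y → subst (_∈ image f (image g s)) fgx≡y (∈-image⁺ f _ (∈-image⁺ g s x∈s))

-- Colourings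

Has : Coloring N k t → Fin t → Subset N → Set
Has c i = Edge (ColorClass c i)

-- Makes the case distinctions on colours finite searches. A colouring takes a proof of the size as
-- argument, and irrelevance of equality on `ℕ` makes the choice of proof immaterial.
Has? : (c : Coloring N k t) (i : Fin t) → Decidable (Has c i)
Has? {k = k} c i s with ∣ s ∣ ℕ.≟ k
... | no  ∣s∣≢k = no λ (p , _) → ∣s∣≢k p
... | yes ∣s∣≡k = map′ (∣s∣≡k ,_)
  (λ (p , eq) → trans (cong (c s) (ℕ.≡-irrelevant ∣s∣≡k p)) eq) (c s ∣s∣≡k Fin.≟ i)

¬Has-zero⇒Has-suc : (c : Coloring N k (suc t)) (s : Subset N) → ∣ s ∣ ≡ k →
  ¬ Has c zero s → Σ (Fin t) λ i → Has c (suc i) s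
¬Has-zero⇒Has-suc c s ∣s∣≡k ¬zero with c s ∣s∣≡k in eq
... | zero  = contradiction (∣s∣≡k , eq) ¬zero
... | suc i = i , ∣s∣≡k , eq

pullback : Coloring N k t → (f : Fin n → Fin N) → OrderEmbedding f → Coloring n k t
pullback c f f-emb s ∣s∣≡k = c (image f s) (trans (∣image∣ f s f-emb) ∣s∣≡k)

Has-pullback : (c : Coloring N k t) {f : Fin n → Fin N} (f-emb : OrderEmbedding f) {i : Fin t} {s : Subset n} →
  Has (pullback c f f-emb) i s → Has c i (image f s)
Has-pullback c f-emb (_ , eq) = _ , eq

onBlock : ∀ B n → Coloring (B * n) k t → Fin B → Coloring n k t
onBlock B n c b = pullback c (combine {n = n} b) λ _ _ → combine-monoʳ-< b

MonoCopy : Matching k e → Coloring N k t → Fin t → Set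
MonoCopy {k} {e} {N} M c i =
  Σ (Fin (k * e) → Fin N) λ f → OrderEmbedding f × (∀ j → Has c i (image f (edge M j)))

MonoCopy⇒⊑ : (M : Matching k e) {c : Coloring N k t} {i : Fin t} →
  MonoCopy M c i → asHypergraph M ⊑ ColorClass c i
MonoCopy⇒⊑ M (f , f-emb , mono) =
  f , f-emb , λ { _ (j , refl) → image f (edge M j) , image-ImageOf f (edge M j) , mono j }

⊑⇒MonoCopy : (M : Matching k e) {c : Coloring N k t} {i : Fin t} →
  asHypergraph M ⊑ ColorClass c i → MonoCopy M c i
⊑⇒MonoCopy M {c} {i} (f , f-emb , edges) = f , f-emb , λ j →
  let s , im , has = edges (edge M j) (j , refl) in
  subst (Has c i) (ImageOf⇒≡image f (edge M j) im) has

MonoCopy-pullback : (M : Matching k e) (c : Coloring N k t)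
  {g : Fin n → Fin N} (g-emb : OrderEmbedding g) {i : Fin t} →
  MonoCopy M (pullback c g g-emb) i → MonoCopy M c i
MonoCopy-pullback M c {g} g-emb {i} (f , f-emb , mono) =
  g ∘ f , (λ x y x<y → g-emb _ _ (f-emb x y x<y)) ,
  λ j → subst (Has c i) (image-∘ g f (edge M j)) (Has-pullback c g-emb (mono j))

-- Layouts and blocks

-- Matching once on the size equation moves `enum` to `Fin k`, so that intervals and blocks share an
-- index type without casts.
enumeration : (K : Subset n) → ∣ K ∣ ≡ k → Σ (Fin k → Fin n) λ κ →
  OrderEmbedding κ × (∀ i → κ i ∈ K) × (∀ b → b ∈ K → Σ (Fin k) λ i → κ i ≡ b)
enumeration K refl = enum K , enum-embedding K , enum-∈ K , λ _ → enum-surjective K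

greatest : {P : Fin n → Set} → Decidable P → ∃ P → Σ (Fin n) λ x → P x × (∀ y → P y → y ≤ᶠ x)
greatest {suc n} {P} P? (x , Px) with any? (P? ∘ suc)
... | yes found = let y , Py , max = greatest (P? ∘ suc) found in
                  suc y , Py , λ { zero _ → z≤n ; (suc z) Pz → s≤s (max z Pz) }
... | no  none  with x
...   | zero  = zero , Px , λ { zero _ → z≤n ; (suc z) Pz → contradiction (z , Pz) none }
...   | suc y = contradiction (y , Px) none

-- Blow up every point of Fin p to a cell of n points, and let g x sit at offset d = g 0 of
-- the cell h x. A point y goes to the cell of the greatest x with g x ≤ y (or x = 0), at
-- offset d + (y − g x). The offset d has to be fixed before h is known.
interpolate : {g : Fin m → Fin n} → OrderEmbedding g → Fin m →
  Σ (Fin n) λ d → ∀ {p} (h : Fin m → Fin p) → OrderEmbedding h →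
  Σ (Fin n → Fin (p * n)) λ l → OrderEmbedding l × (∀ x → l (g x) ≡ combine (h x) d)
interpolate {suc m} {n} {g} g-emb _ = g zero , extend
  where
  g-mono : ∀ {x y} → x ≤ᶠ y → g x ≤ᶠ g y
  g-mono {x} {y} x≤y with x Fin.≟ y
  ... | yes refl = ℕ.≤-refl
  ... | no  x≢y  = ℕ.<⇒≤ (g-emb x y (Fin.≤∧≢⇒< x≤y x≢y))

  Before : Fin n → Fin (suc m) → Set
  Before y x = x ≡ zero ⊎ g x ≤ᶠ y

  before? : ∀ y → Decidable (Before y)
  before? y x = (x Fin.≟ zero) ⊎-dec (g x Fin.≤? y)

  last : ∀ y → Σ (Fin (suc m)) λ x → Before y x × (∀ z → Before y z → z ≤ᶠ x)
  last y = greatest (before? y) (zero , inj₁ refl)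

  π : Fin n → Fin (suc m)
  π = proj₁ ∘ last

  π-before : ∀ y → Before y (π y)
  π-before = proj₁ ∘ proj₂ ∘ last

  π-max : ∀ y z → Before y z → z ≤ᶠ π y
  π-max = proj₂ ∘ proj₂ ∘ last

  π-mono : ∀ {y z} → y <ᶠ z → π y ≤ᶠ π z
  π-mono {y} {z} y<z with π-before y
  ... | inj₁ eq = π-max z (π y) (inj₁ eq)
  ... | inj₂ le = π-max z (π y) (inj₂ (ℕ.≤-trans le (ℕ.<⇒≤ y<z)))

  π-g : ∀ x → π (g x) ≡ x
  π-g x with π x' | π-before x' | π-max x' x (inj₂ ℕ.≤-refl)
    where x' = g x
  ... | y | inj₁ refl | x≤y = sym (Fin.≤-antisym x≤y z≤n)
  ... | y | inj₂ gy≤gx | x≤y with x Fin.≟ y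
  ...   | yes x≡y = sym x≡y
  ...   | no  x≢y = contradiction gy≤gx (ℕ.<⇒≱ (g-emb x y (Fin.≤∧≢⇒< x≤y x≢y)))

  d : ℕ
  d = toℕ (g zero)

  -- Keeps the truncated subtraction in `offset` exact, as strict monotonicity within a cell
  -- requires; adding `d` covers the points below `g zero`.
  g-π≤ : ∀ y → toℕ (g (π y)) ≤ d + toℕ y
  g-π≤ y with π-before y
  ... | inj₁ eq = subst (λ x → toℕ (g x) ≤ d + toℕ y) (sym eq) (ℕ.m≤m+n d (toℕ y))
  ... | inj₂ le = ℕ.≤-trans le (ℕ.m≤n+m (toℕ y) d)

  offset< : ∀ y → d + toℕ y ∸ toℕ (g (π y)) < n
  offset< y = ℕ.≤-<-trans
    (ℕ.≤-trans (ℕ.∸-monoʳ-≤ (d + toℕ y) (g-mono {zero} z≤n)) (ℕ.≤-reflexive (ℕ.m+n∸m≡n d (toℕ y))))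
    (Fin.toℕ<n y)

  offset : Fin n → Fin n
  offset y = fromℕ< (offset< y)

  offset-mono : ∀ {y z} → π y ≡ π z → y <ᶠ z → offset y <ᶠ offset z
  offset-mono {y} {z} eq y<z =
    subst₂ _<_ (sym (Fin.toℕ-fromℕ< (offset< y))) (sym (Fin.toℕ-fromℕ< (offset< z)))
      (subst (λ x → d + toℕ y ∸ toℕ (g (π y)) < d + toℕ z ∸ toℕ (g x)) eq
        (ℕ.∸-monoˡ-< (ℕ.+-monoʳ-< d y<z) (g-π≤ y)))

  offset-g : ∀ x → offset (g x) ≡ g zero
  offset-g x = toℕ-injective (trans (Fin.toℕ-fromℕ< (offset< (g x)))
    (trans (cong (λ z → d + toℕ (g x) ∸ toℕ (g z)) (π-g x)) (ℕ.m+n∸n≡m d (toℕ (g x)))))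

  extend : ∀ {p} (h : Fin (suc m) → Fin p) → OrderEmbedding h →
    Σ (Fin n → Fin (p * n)) λ l → OrderEmbedding l × (∀ x → l (g x) ≡ combine (h x) (g zero))
  extend h h-emb = l , l-emb , λ x → cong₂ combine (cong h (π-g x)) (offset-g x)
    where
    l : Fin n → Fin _
    l y = combine (h (π y)) (offset y)
    l-emb : OrderEmbedding l
    l-emb y z y<z with π y Fin.≟ π z
    ... | yes eq = subst (λ x → l y <ᶠ combine (h x) (offset z)) eq
                     (combine-monoʳ-< (h (π y)) (offset-mono eq y<z))
    ... | no neq = Fin.combine-monoˡ-< (offset y) (offset z)
                     (h-emb _ _ (Fin.≤∧≢⇒< (π-mono y<z) neq))

-- Adding one colour

∀⊎⇒∀⊎ : {X : Fin n → Set} {Y : Set} → (∀ i → X i ⊎ Y) → (∀ i → X i) ⊎ Y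
∀⊎⇒∀⊎ {zero}  f = inj₁ λ ()
∀⊎⇒∀⊎ {suc n} f with f zero | ∀⊎⇒∀⊎ (f ∘ suc)
... | inj₂ y | _      = inj₂ y
... | inj₁ _ | inj₂ y = inj₂ y
... | inj₁ x | inj₁ g = inj₁ λ { zero → x ; (suc i) → g i }

-- The power `B ^ (2e − 1)` for positive `e`, written as a product so that the cut into `B` blocks
-- holds by definition.
bound : ℕ → ℕ → ℕ
bound B e = B * B ^ (2 * (e ∸ 1))

-- The target `M₀` stays fixed while the red matching shrinks along the nesting; `ramsey` is the
-- hypothesis for one colour fewer. Colour `zero` is red.
module Step {k e₀ t B} (M₀ : Matching k e₀) (2≤k : 2 ≤ k)
  (ramsey : RamseyAt k t (asHypergraph M₀) B) where

  NonRedCopy : Coloring N k (suc t) → Set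
  NonRedCopy c = Σ (Fin t) λ i → MonoCopy M₀ c (suc i)

  -- The colours of the transversals colour the k-sets of blocks; a monochromatic copy of M₀
  -- among the blocks lifts because its edges are disjoint, so each block is entered once.
  transversal : (c : Coloring (B * n) k (suc t)) →
    (∀ K → ∣ K ∣ ≡ k → Σ (Fin B → Fin n) λ r →
      Σ (Fin t) λ i → Has c (suc i) (image (λ b → combine b (r b)) K)) →
    NonRedCopy c
  transversal {n} c choose = lift (⊑⇒MonoCopy M₀ (proj₂ (ramsey c')))
    where
    c' : Coloring B k t
    c' K ∣K∣≡k = proj₁ (proj₂ (choose K ∣K∣≡k))

    lift : ∀ {i} → MonoCopy M₀ c' i → NonRedCopy c
    lift {i} (f , f-emb , mono) = i , h , h-emb , h-mono
      where
      blocks : Fin e₀ → Subset B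
      blocks j = image f (edge M₀ j)

      ∣blocks∣ : ∀ j → ∣ blocks j ∣ ≡ k
      ∣blocks∣ j = trans (∣image∣ f (edge M₀ j) f-emb) (size M₀ j)

      ρ : Fin e₀ → Fin B → Fin (B * n)
      ρ j b = combine b (proj₁ (choose (blocks j) (∣blocks∣ j)) b)

      owner : Fin (k * e₀) → Fin e₀
      owner x = proj₁ (cover M₀ x)

      owner-unique : ∀ j x → x ∈ edge M₀ j → owner x ≡ j
      owner-unique j x x∈ with owner x Fin.≟ j
      ... | yes eq = eq
      ... | no neq = ⊥-elim (disjoint M₀ _ _ neq x (proj₂ (cover M₀ x)) x∈)

      h : Fin (k * e₀) → Fin (B * n)
      h x = ρ (owner x) (f x)

      h-emb : OrderEmbedding h
      -- The block decides the order, so edges may use unrelated offsets.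
      h-emb x y x<y = Fin.combine-monoˡ-< _ _ (f-emb x y x<y)

      h-mono : ∀ j → Has c (suc i) (image h (edge M₀ j))
      h-mono j = subst (Has c (suc i))
        (trans (image-∘ (ρ j) f (edge M₀ j))
               (image-cong λ x x∈ → cong (λ j → ρ j (f x)) (sym (owner-unique j x x∈))))
        (subst (λ i → Has c (suc i) (image (ρ j) (blocks j))) colour
               (proj₂ (proj₂ (choose (blocks j) (∣blocks∣ j)))))
        where
        colour : proj₁ (proj₂ (choose (blocks j) (∣blocks∣ j))) ≡ i
        colour = let p , eq = mono j in
          trans (cong (c' (blocks j)) (ℕ.≡-irrelevant (∣blocks∣ j) p)) eq

  Inside : Matching k e → (Fin (k * e) → Fin k) → Fin k → Fin e → Set
  Inside M φ i j = ∀ x → x ∈ edge M j → φ x ≡ i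

  -- All vertices of `M` get a position, although only edges inside interval `i` must be red:
  -- vertices of crossing edges in that interval need places too.
  Layout : Matching k e → (Fin (k * e) → Fin k) → Coloring n k (suc t) → Fin k → Set
  Layout {e} {n} M φ c i = Σ (Fin (k * e) → Fin n) λ l →
    OrderEmbedding l × (∀ j → Inside M φ i j → Has c zero (image l (edge M j)))

  module _ (M : Matching k e) (φ : Fin (k * e) → Fin k) (φ-mono : ∀ x y → x ≤ᶠ y → φ x ≤ᶠ φ y)
    (dichotomy : ∀ j → Σ (Fin k) (λ i → Inside M φ i j)
                     ⊎ (∀ i → Σ (Fin (k * e)) λ x → x ∈ edge M j × φ x ≡ i))
    (c : Coloring (B * n) k (suc t))
    (layout : ∀ b i → Layout M φ (onBlock B n c b) i) where

    private
      l : Fin B → Fin k → Fin (k * e) → Fin n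
      l b i = proj₁ (layout b i)

      module _ (K : Subset B) (∣K∣≡k : ∣ K ∣ ≡ k) where
        κ : Fin k → Fin B
        κ = proj₁ (enumeration K ∣K∣≡k)

        rank : Fin B → Fin k
        rank b with any? (λ i → κ i Fin.≟ b)
        ... | yes (i , _) = i
        -- An arbitrary default: only blocks in `K` enter `image ρ K`.
        ... | no  _       = fromℕ< 2≤k

        κ-rank : ∀ b → b ∈ K → κ (rank b) ≡ b
        κ-rank b b∈K with any? (λ i → κ i Fin.≟ b)
        ... | yes (_ , eq) = eq
        ... | no  none     = contradiction (proj₂ (proj₂ (proj₂ (enumeration K ∣K∣≡k))) b b∈K) none

        place : Fin (k * e) → Fin (B * n)
        place x = combine (κ (φ x)) (l (κ (φ x)) (φ x) x)

        place-in : ∀ {i b x} → φ x ≡ i → κ i ≡ b → place x ≡ combine b (l b i x)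
        place-in refl refl = refl

        place-emb : OrderEmbedding place
        place-emb x y x<y with φ x Fin.≟ φ y
        ... | yes eq = subst₂ _<ᶠ_ (sym (place-in eq refl)) (sym (place-in {x = y} refl refl))
                         (combine-monoʳ-< (κ (φ y)) (proj₁ (proj₂ (layout (κ (φ y)) (φ y))) x y x<y))
        ... | no neq = Fin.combine-monoˡ-< _ _
                         (proj₁ (proj₂ (enumeration K ∣K∣≡k)) _ _
                           (Fin.≤∧≢⇒< (φ-mono x y (ℕ.<⇒≤ x<y)) neq))

        place-inside : ∀ {i j} → Inside M φ i j → Has c zero (image place (edge M j))
        place-inside {i} {j} ins = subst (Has c zero)
          (trans (image-∘ (combine (κ i)) (l (κ i) i) (edge M j))
                 (image-cong λ x x∈ → sym (place-in (ins x x∈) refl)))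
          (Has-pullback c (λ _ _ → combine-monoʳ-< (κ i)) (proj₂ (proj₂ (layout (κ i) i)) j ins))

        -- Edges inside an interval are red by the layouts, so a non-red edge meets all `k`
        -- intervals. Having only `k` vertices, it has exactly one in each block of `K`; hence one
        -- inclusion and a count identify it with `image ρ K`.
        nonRedEdge⇒transversal : ∀ {j} → ¬ Has c zero (image place (edge M j)) →
          Σ (Fin B → Fin n) λ r → Σ (Fin t) λ i → Has c (suc i) (image (λ b → combine b (r b)) K)
        nonRedEdge⇒transversal {j} ¬red with dichotomy j
        ... | inj₁ (i , ins) = contradiction (place-inside ins) ¬red
        ... | inj₂ v = r , ¬Has-zero⇒Has-suc c _ ∣ρK∣≡k (¬red ∘ subst (Has c zero) ρK≡edge)
          where
          r : Fin B → Fin n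
          r b = l b (rank b) (proj₁ (v (rank b)))

          ρ : Fin B → Fin (B * n)
          ρ b = combine b (r b)

          ∣ρK∣≡k : ∣ image ρ K ∣ ≡ k
          ∣ρK∣≡k = trans (∣image∣ ρ K λ _ _ → Fin.combine-monoˡ-< _ _) ∣K∣≡k

          ρK≡edge : image ρ K ≡ image place (edge M j)
          ρK≡edge = ⊆∧∣≡∣⇒≡
            (λ y∈ → let b , b∈K , ρb≡y = ∈-image⁻ ρ K y∈
                        x , x∈ , φx≡i = v (rank b) in
              subst (_∈ image place (edge M j)) (trans (place-in φx≡i (κ-rank b b∈K)) ρb≡y)
                    (∈-image⁺ place (edge M j) x∈))
            (trans ∣ρK∣≡k (sym (trans (∣image∣ place (edge M j) place-emb) (size M j))))

      -- The size is part of the predicate because the search runs over all subsets.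
      Placed : Subset B → Set
      Placed K = Σ (∣ K ∣ ≡ k) λ p → ∀ j → Has c zero (image (place K p) (edge M j))

      placed? : Decidable Placed
      placed? K with ∣ K ∣ ℕ.≟ k
      ... | no  ∣K∣≢k = no (∣K∣≢k ∘ proj₁)
      ... | yes ∣K∣≡k = map′ (∣K∣≡k ,_)
        (λ (p , red) → subst (λ p → ∀ j → Has c zero (image (place K p) (edge M j)))
                             (ℕ.≡-irrelevant p ∣K∣≡k) red)
        (all? λ j → Has? c zero (image (place K ∣K∣≡k) (edge M j)))

    assemble : MonoCopy M c zero ⊎ NonRedCopy c
    assemble with anySubset? placed?
    ... | yes (K , p , red) = inj₁ (place K p , place-emb K p , red)
    ... | no  none = inj₂ (transversal c λ K p →
      nonRedEdge⇒transversal K p (proj₂ (Fin.¬∀⟶∃¬ e _ (λ j → Has? c zero (image (place K p) (edge M j)))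
        λ red → none (K , p , red))))

  -- Any red `k`-set is already a copy of a one-edge matching. If there is none, the blocks are
  -- single points and `transversal` applies with the only possible representatives.
  singleEdge : (M : Matching k 1) (c : Coloring (B * 1) k (suc t)) → MonoCopy M c zero ⊎ NonRedCopy c
  singleEdge M c with anySubset? (Has? c zero)
  ... | no none = inj₂ (transversal c λ K p → (λ _ → zero) ,
    ¬Has-zero⇒Has-suc c _ (trans (∣image∣ _ K λ _ _ → Fin.combine-monoˡ-< {n = 1} zero zero) p)
      λ red → none (_ , red))
  ... | yes (S , p , red) = inj₁ (f , f-emb , λ j → subst (Has c zero) (sym (f-edge j)) (p , red))
    where
    eq = ℕ.*-identityʳ k
    f : Fin (k * 1) → Fin (B * 1)
    f x = proj₁ (enumeration S p) (cast eq x)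
    f-emb : OrderEmbedding f
    f-emb x y x<y = proj₁ (proj₂ (enumeration S p)) _ _
      (subst₂ _<_ (sym (Fin.toℕ-cast eq x)) (sym (Fin.toℕ-cast eq y)) x<y)
    f-edge : ∀ j → image f (edge M j) ≡ S
    f-edge j = ⊆∧∣≡∣⇒≡
      (λ y∈ → let x , _ , fx≡y = ∈-image⁻ f (edge M j) y∈ in
        subst (_∈ S) fx≡y (proj₁ (proj₂ (proj₂ (enumeration S p))) (cast eq x)))
      (trans (∣image∣ f (edge M j) f-emb) (trans (size M j) (sym p)))

  B-nonZero : k * suc e ≤ B → NonZero B
  B-nonZero {e} ke≤B = >-nonZero (ℕ.≤-trans (ℕ.≤-trans (ℕ.<⇒≤ 2≤k) (ℕ.m≤m*n k (suc e))) ke≤B)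

  -- Room for the inner matching: `B ^ (2e' − 1)` cells of at most `B` points each take `B ^ (2e')`
  -- points. Each level of nesting thus costs one factor `B` for the spacing and one for the blocks.
  subbound : ∀ {e' e₁} → k * suc e₁ ≤ B → e' < suc e₁ → Fin (k * e') →
    bound B e' * (k * suc e₁) ≤ B ^ (2 * e₁)
  subbound {zero}  _ _ x = contradiction (subst Fin (ℕ.*-zeroʳ k) x) λ ()
  subbound {suc e'} {e₁} ke≤B (s≤s e'<e₁) _ = begin
    B * B ^ (2 * e') * (k * suc e₁) ≤⟨ ℕ.*-monoʳ-≤ (B * B ^ (2 * e')) ke≤B ⟩
    B * B ^ (2 * e') * B            ≡⟨ ℕ.*-comm (B * B ^ (2 * e')) B ⟩
    B ^ (2 + 2 * e')                ≡⟨ cong (B ^_) (sym (ℕ.*-suc 2 e')) ⟩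
    B ^ (2 * suc e')                ≤⟨ ℕ.^-monoʳ-≤ B (ℕ.*-monoʳ-≤ 2 e'<e₁) ⟩
    B ^ (2 * e₁)                    ∎
    where
    open ℕ.≤-Reasoning
    instance _ = B-nonZero {e₁} ke≤B

  -- The recursion follows the nestability derivation; the falling number of edges only serves to
  -- fit the inner matching into a block.
  redOrNonRed : (M : Matching k e) → Nestable M → k * e ≤ B → (c : Coloring (bound B e) k (suc t)) →
    MonoCopy M c zero ⊎ NonRedCopy c
  redOrNonRed {zero} M (nest φ _ (x , _) _ _ _) _ _ = contradiction (subst Fin (ℕ.*-zeroʳ k) x) λ ()
  redOrNonRed {suc zero} M _ _ c = singleEdge M c
  redOrNonRed {e@(suc e₁@(suc e₂))} M
    (nest φ φ-mono (first , _ , φ-first) (last , _ , φ-last) dichotomy sub) ke≤B c =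
    combineLayouts (∀⊎⇒∀⊎ λ b → ∀⊎⇒∀⊎ (layout b))
    where
    combineLayouts : (∀ b i → Layout M φ (onBlock B (B ^ (2 * e₁)) c b) i) ⊎ NonRedCopy c →
      MonoCopy M c zero ⊎ NonRedCopy c
    combineLayouts (inj₁ layouts) = assemble M φ φ-mono dichotomy c layouts
    combineLayouts (inj₂ other)   = inj₂ other

    -- The first and last vertices lie in the first and last intervals, which differ as `k` is at
    -- least 2. So no interval contains every vertex.
    elsewhere : ∀ i → Σ (Fin (k * e)) λ z → φ z ≢ i
    elsewhere i with φ first Fin.≟ i
    ... | no  neq = first , neq
    ... | yes eq  = last , λ eq' → ℕ.<⇒≢ (ℕ.m<n⇒0<n∸m 2≤k)
      (trans (sym φ-first) (trans (cong toℕ (trans eq (sym eq'))) φ-last))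

    ke≤m : k * e ≤ B ^ (2 * e₁)
    ke≤m = ℕ.≤-trans ke≤B (subst (_≤ B ^ (2 * e₁)) (ℕ.^-identityʳ B)
      (ℕ.^-monoʳ-≤ B {{B-nonZero {e₁} ke≤B}} {1} {2 * e₁} (s≤s z≤n)))

    layout : ∀ b i → Layout M φ (onBlock B (B ^ (2 * e₁)) c b) i ⊎ NonRedCopy c
    layout b i with sub i
    -- With no edge inside the interval, any embedding into the block is a layout.
    ... | inj₁ none = inj₁ ((λ x → inject≤ x ke≤m) , inject≤-embedding ke≤m ,
                            λ j ins → contradiction ins (none j))
    -- Nestability of `M'` supplies a vertex `x₀`, which shows that `e'` is positive and that `g`
    -- has a first value.
    ... | inj₂ (e' , M' , g , g-emb , fwd , bwd , nested@(nest _ _ (x₀ , _) _ _ _)) =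
      transport (redOrNonRed M' nested ke'≤B (pullback (onBlock B (B ^ (2 * e₁)) c b) rep rep-emb))
      where
      φ∘g : ∀ x → φ (g x) ≡ i
      φ∘g x = let j' , x∈ = cover M' x
                  j , ins , im = fwd j' in
              ins (g x) (proj₂ (im (g x)) x x∈ refl)

      ke'<ke : k * e' < k * e
      ke'<ke = let z , φz≢i = elsewhere i in
        embedding-missing⇒< g-emb z λ x gx≡z → φz≢i (trans (cong φ (sym gx≡z)) (φ∘g x))

      ke'≤B : k * e' ≤ B
      ke'≤B = ℕ.≤-trans (ℕ.<⇒≤ ke'<ke) ke≤B

      fits : bound B e' * (k * e) ≤ B ^ (2 * e₁)
      fits = subbound ke≤B (ℕ.*-cancelˡ-< k e' e ke'<ke) x₀

      d : Fin (k * e)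
      d = proj₁ (interpolate g-emb x₀)

      -- One point per cell of `k * e` points, always at offset `d`. The recursive call sees only
      -- these points; the rest of each cell is kept for vertices outside `M'`.
      rep : Fin (bound B e') → Fin (B ^ (2 * e₁))
      rep u = inject≤ (combine u d) fits

      rep-emb : OrderEmbedding rep
      rep-emb u v u<v = inject≤-embedding fits _ _ (Fin.combine-monoˡ-< d d u<v)

      transport : MonoCopy M' (pullback (onBlock B (B ^ (2 * e₁)) c b) rep rep-emb) zero
                  ⊎ NonRedCopy (pullback (onBlock B (B ^ (2 * e₁)) c b) rep rep-emb) →
        Layout M φ (onBlock B (B ^ (2 * e₁)) c b) i ⊎ NonRedCopy c
      transport (inj₂ (i' , copy)) = inj₂ (i' ,
        MonoCopy-pullback M₀ c (λ _ _ → combine-monoʳ-< b)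
          (MonoCopy-pullback M₀ (onBlock B (B ^ (2 * e₁)) c b) rep-emb copy))
      transport (inj₁ (h , h-emb , mono)) =
        let l , l-emb , l-g = proj₂ (interpolate g-emb x₀) h h-emb in
        inj₁ ((λ y → inject≤ (l y) fits) ,
              (λ y z y<z → inject≤-embedding fits _ _ (l-emb y z y<z)) ,
              -- By `l-g`, the layout composed with `g` is `rep ∘ h`, so edges inside the interval
              -- inherit their colour from the red copy of `M'`.
              λ j ins → let j' , im = bwd j ins in
                subst (Has (onBlock B (B ^ (2 * e₁)) c b) zero)
                  (trans (image-∘ rep h (edge M' j'))
                  (trans (image-cong λ x _ → cong (λ v → inject≤ v fits) (sym (l-g x)))
                  (trans (sym (image-∘ (λ y → inject≤ (l y) fits) g (edge M' j')))
                         (cong (image _) (sym (ImageOf⇒≡image g _ im))))))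
                  (Has-pullback (onBlock B (B ^ (2 * e₁)) c b) rep-emb (mono j')))

-- Induction on the number of colours

bound≡^ : ∀ B e → 1 ≤ e → bound B e ≡ B ^ (2 * e ∸ 1)
bound≡^ B (suc e) _ = cong (B ^_) (sym (ℕ.+-suc e (e + 0)))

theorem14 : (k e t : ℕ) → 3 ≤ k → 2 ≤ e → 1 ≤ t →
    (M : Matching k e) → Nestable M →
    RamseyLe k t (asHypergraph M) ((e * k) ^ ((2 * e ∸ 1) ^ (t ∸ 1)))
theorem14 k e (suc t) 3≤k 2≤e _ M nestable = _ , ℕ.≤-refl , ramsey t
  where
  1≤e : 1 ≤ e
  1≤e = ℕ.<⇒≤ 2≤e

  instance
    _ = >-nonZero (ℕ.*-mono-≤ 1≤e (ℕ.≤-trans (s≤s z≤n) 3≤k))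
    _ = >-nonZero (ℕ.m<n⇒0<n∸m (ℕ.≤-trans 2≤e (ℕ.m≤m+n e (e + 0))))

  -- Serves `t + 1` colours, hence the exponent `t`.
  V : ℕ → ℕ
  V t = (e * k) ^ ((2 * e ∸ 1) ^ t)

  ke≤V : ∀ t → k * e ≤ V t
  ke≤V t = subst (_≤ V t) (trans (ℕ.^-identityʳ (e * k)) (ℕ.*-comm e k))
    (ℕ.^-monoʳ-≤ (e * k) (ℕ.m^n>0 (2 * e ∸ 1) t))

  -- Each new colour raises the bound to the power `2e − 1`, which multiplies the exponent of
  -- `e * k` by that number.
  V-suc : ∀ t → bound (V t) e ≡ V (suc t)
  V-suc t = begin
    bound (V t) e                              ≡⟨ bound≡^ (V t) e 1≤e ⟩
    V t ^ (2 * e ∸ 1)                          ≡⟨ ℕ.^-*-assoc (e * k) ((2 * e ∸ 1) ^ t) (2 * e ∸ 1) ⟩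
    (e * k) ^ ((2 * e ∸ 1) ^ t * (2 * e ∸ 1))  ≡⟨ cong ((e * k) ^_) (ℕ.*-comm ((2 * e ∸ 1) ^ t) (2 * e ∸ 1)) ⟩
    V (suc t)                                  ∎
    where open ≡-Reasoning

  ramsey : ∀ t → RamseyAt k (suc t) (asHypergraph M) (V t)
  -- With a single colour, `M` only has to fit, and `V 0` offers `e * k` points.
  ramsey zero c = zero , MonoCopy⇒⊑ M (f , f-emb , λ j →
      trans (∣image∣ f (edge M j) f-emb) (size M j) , all-zero _)
    where
    f : Fin (k * e) → Fin (V 0)
    f x = inject≤ x (ke≤V 0)

    f-emb : OrderEmbedding f
    f-emb = inject≤-embedding (ke≤V 0)

    all-zero : (i : Fin 1) → i ≡ zero
    all-zero zero = refl
  ramsey (suc t) = subst (RamseyAt k (suc (suc t)) (asHypergraph M)) (V-suc t) step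
    where
    open Step M (ℕ.<⇒≤ 3≤k) (ramsey t)

    step : RamseyAt k (suc (suc t)) (asHypergraph M) (bound (V t) e)
    step c with redOrNonRed M nestable (ke≤V t) c
    ... | inj₁ copy       = zero , MonoCopy⇒⊑ M copy
    ... | inj₂ (i , copy) = suc i , MonoCopy⇒⊑ M copy
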